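{- If a $\Lambda$-structure over $T$ is finitary one-step compact and all its operators are bounded, then it has quasi-ultraproducts: for every set $I$, every family $(C_i)_{i\in I}=(X_i,\xi_i)_{i\in I}$ of $T$-coalgebras with nonempty carriers and every ultrafilter $\mathfrak U$ on $I$, there exists a quasi-ultraproduct of the $C_i$ for $\mathfrak U$.
   Context: $\Lambda$ is a set of unary modal operators. A $\Lambda$-structure is a functor $T:\mathsf{Set}\to\mathsf{Set}$ with, for each $\heartsuit\in\Lambda$, maps $\llbracket\heartsuit\rrbracket_X:\mathcal P(X)\to\mathcal P(TX)$ for all sets $X$, natural: $(Tf)^{ -1}[\llbracket\heartsuit\rrbracket_Y(B)]=\llbracket\heartsuit\rrbracket_X(f^{ -1}[B])$ for $f:X\to Y$, $B\subseteq Y$. A $T$-coalgebra is a pair $(X,\xi)$ with $\xi:X\to TX$. For a family $\mathcal S\subseteq\mathcal P(X)$, $\mathsf{Prop}(\Lambda(\mathcal S))$ is the set of Boolean combinations of formal expressions $\heartsuit A$ with $\heartsuit\in\Lambda$, $A\in\mathcal S$ (one-step formulas over $X$). For $t\in TX$, $t\models\heartsuit A$ iff $t\in\llbracket\heartsuit\rrbracket_X(A)$, extended to Boolean combinations as usual. A set of one-step formulas over $X$ is satisfiable if some $t\in TX$ satisfies all its members. The structure is finitary one-step compact if for every set $X$, every $\Phi\subseteq\mathsf{Prop}(\Lambda(\mathcal P_{\mathit{fin}}(X)))$ all of whose finite subsets are satisfiable is satisfiable ($\mathcal P_{\mathit{fin}}(X)$ is the set of finite subsets of $X$). An operator $\heartsuit$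 is bounded if it is $k$-bounded for some $k\in\mathbb N$, i.e. $\llbracket\heartsuit\rrbracket_X(A)=\bigcup_{B\subseteq A,\,\#B\le k}\llbracket\heartsuit\rrbracket_X(B)$ for all sets $X$ and $A\subseteq X$. The ultraproduct of nonempty sets $X_i$ is $\prod_{\mathfrak U}X_i=(\prod_{i\in I}X_i)/{\sim}$ with $x\sim y$ iff $\{i\mid x_i=y_i\}\in\mathfrak U$; elements are written as representatives $x=(x_i)$. For $A_i\subseteq X_i$, $\prod_{\mathfrak U}A_i:=\{x\in\prod_{\mathfrak U}X_i\mid\{i\mid x_i\in A_i\}\in\mathfrak U\}$. A coalgebra $\xi:X\to TX$ on $X=\prod_{\mathfrak U}X_i$ is a quasi-ultraproduct of the $C_i=(X_i,\xi_i)$ if for every family $(A_i)$ of subsets $A_i\subseteq X_i$, every $x\in X$ and every $\heartsuit\in\Lambda$: $\xi(x)\in\llbracket\heartsuit\rrbracket_X(\prod_{\mathfrak U}A_i)\iff\{i\in I\mid\xi_i(x_i)\in\llbracket\heartsuit\rrbracket_{X_i}(A_i)\}\in\mathfrak U$. -}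

module Defs where

open import Axiom.ExcludedMiddle using (ExcludedMiddle)
open import Axiom.Extensionality.Propositional using (Extensionality)
open import Data.Bool using (Bool; true; T)
open import Data.Bool.Properties using (T-irrelevant)
open import Data.Empty using (⊥)
open import Data.List using (List; length)
open import Data.List.Membership.Propositional using (_∈_)
open import Data.Nat using (ℕ; _≤_)
open import Data.Product using (Σ; ∃; ∃-syntax; _×_; _,_; proj₁; proj₂)
open import Data.Sum using (_⊎_)
open import Data.Unit using (⊤)
open import Function using (_∘_; id; _⇔_; Bijection)
open import Level using (Level; 0ℓ) renaming (suc to lsuc)
open import Relation.Binary using (Setoid)
open import Relation.Binary.PropositionalEquality
  using (_≡_; _≗_; refl; sym; trans; cong; setoid)
open import Relation.Nullary using (¬_; Dec; yes; no; does; contradiction)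
open import Relation.Nullary.Decidable using (True; toWitness; fromWitness)
open import Relation.Unary using (Pred; _⊆_; _≐_; _∩_; ∁; U; ∅; _⊢_)

private
  variable
    a p : Level

-- Sets are modelled by types in Set, functions by Agda functions, and the
-- powerset of X by Pred X 0ℓ, where equality of subsets is _≐_.
𝒫 : Set → Set₁
𝒫 X = Pred X 0ℓ

-- The list may contain repetitions, so it only bounds the cardinality.
#_≤ᶜ_ : {A : Set a} → Pred A p → ℕ → Set _
# P ≤ᶜ k = ∃[ xs ] length xs ≤ k × P ≐ (_∈ xs)

Finite : {A : Set a} → Pred A p → Set _
Finite P = ∃[ k ] # P ≤ᶜ k

------------------------------------------------------------------------
-- Coalgebras and Λ-structures

record Functor : Set₁ where
  field
    F₀           : Set → Set
    F₁           : {X Y : Set} → (X → Y) → F₀ X → F₀ Y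
    identity     : {X : Set} → F₁ {X} id ≗ id
    homomorphism : {X Y Z : Set} (f : X → Y) (g : Y → Z) →
                   F₁ (g ∘ f) ≗ F₁ g ∘ F₁ f

record Coalgebra (F : Functor) : Set₁ where
  open Functor F
  field
    Carrier : Set
    ξ       : Carrier → F₀ Carrier

-- The field ⟦⟧-cong makes ⟦ ♥ ⟧ a function on subsets up to _≐_.
record Structure (Λ : Set) (F : Functor) : Set₁ where
  open Functor F
  field
    ⟦_⟧     : Λ → {X : Set} → 𝒫 X → 𝒫 (F₀ X)
    ⟦⟧-cong : ∀ ♥ {X} {A B : 𝒫 X} → A ≐ B → ⟦ ♥ ⟧ A ≐ ⟦ ♥ ⟧ B
    natural : ∀ ♥ {X Y} (f : X → Y) (B : 𝒫 Y) →
              (F₁ f ⊢ ⟦ ♥ ⟧ B) ≐ ⟦ ♥ ⟧ (f ⊢ B)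

-- Formula Λ 𝒮 is Prop(Λ(𝒮)).  An atom carries the evidence for A ∈ 𝒮, so it
-- may occur in several copies; its meaning does not depend on the evidence.
data Formula (Λ : Set) {X : Set} (𝒮 : Pred (𝒫 X) 0ℓ) : Set₁ where
  atom        : Λ → (A : 𝒫 X) → 𝒮 A → Formula Λ 𝒮
  ⊤ᶠ ⊥ᶠ       : Formula Λ 𝒮
  ¬ᶠ_         : Formula Λ 𝒮 → Formula Λ 𝒮
  _∧ᶠ_ _∨ᶠ_   : Formula Λ 𝒮 → Formula Λ 𝒮 → Formula Λ 𝒮

module _ {Λ : Set} {F : Functor} (S : Structure Λ F) where
  open Functor F
  open Structure S

  Holds : {X : Set} {𝒮 : Pred (𝒫 X) 0ℓ} → F₀ X → Formula Λ 𝒮 → Set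
  Holds t (atom ♥ A _) = ⟦ ♥ ⟧ A t
  Holds t ⊤ᶠ           = ⊤
  Holds t ⊥ᶠ           = ⊥
  Holds t (¬ᶠ φ)       = ¬ Holds t φ
  Holds t (φ ∧ᶠ ψ)     = Holds t φ × Holds t ψ
  Holds t (φ ∨ᶠ ψ)     = Holds t φ ⊎ Holds t ψ

  -- Formulas form a type in Set₁, so sets of formulas are predicates at level
  -- one; this includes the singletons _≡ φ.
  Satisfiable : {X : Set} {𝒮 : Pred (𝒫 X) 0ℓ} →
                Pred (Formula Λ 𝒮) (lsuc 0ℓ) → Set₁
  Satisfiable Φ = ∃[ t ] (∀ φ → Φ φ → Holds t φ)

  FinitaryOneStepCompact : Set₂
  FinitaryOneStepCompact =
    (X : Set) (Φ : Pred (Formula Λ {X} Finite) (lsuc 0ℓ)) →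
    ((Ψ : Pred (Formula Λ Finite) (lsuc 0ℓ)) →
       Ψ ⊆ Φ → Finite Ψ → Satisfiable Ψ) →
    Satisfiable Φ

  _-Bounded_ : ℕ → Λ → Set₁
  k -Bounded ♥ = (X : Set) (A : 𝒫 X) →
    ⟦ ♥ ⟧ A ≐ (λ t → ∃[ B ] (B ⊆ A) × (# B ≤ᶜ k) × ⟦ ♥ ⟧ B t)

  Bounded : Λ → Set₁
  Bounded ♥ = ∃[ k ] k -Bounded ♥

------------------------------------------------------------------------
-- Ultraproducts

record Ultrafilter (I : Set) : Set₁ where
  field
    Large  : Pred (𝒫 I) 0ℓ
    whole  : Large U
    upward : {A B : 𝒫 I} → A ⊆ B → Large A → Large B
    meet   : {A B : 𝒫 I} → Large A → Large B → Large (A ∩ B)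
    proper : ¬ Large ∅
    ultra  : (A : 𝒫 I) → Large A ⊎ Large (∁ A)

module _ {I : Set} (𝔘 : Ultrafilter I) (X : I → Set) where
  open Ultrafilter 𝔘

  agreeSetoid : Setoid 0ℓ 0ℓ
  agreeSetoid = record
    { Carrier       = ∀ i → X i
    ; _≈_           = λ x y → Large (λ i → x i ≡ y i)
    ; isEquivalence = record
      { refl  = upward (λ _ → refl) whole
      ; sym   = upward sym
      ; trans = λ p q → upward (λ (e , f) → trans e f) (meet p q)
      }
    }

-- The ambient mathematics is classical set theory.  Excluded middle for types
-- (rather than for truncated propositions) also provides choice functions, and
-- together with function extensionality it gives quotients of setoids as types
-- of equivalence classes.
module Classical (em : ExcludedMiddle 0ℓ) (ext : Extensionality 0ℓ 0ℓ) where

  module Quotient (S : Setoid 0ℓ 0ℓ) where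
    open Setoid S using (_≈_) renaming
      (Carrier to A; refl to ≈-refl; sym to ≈-sym; trans to ≈-trans)

    class : A → A → Bool
    class x y = does (em {x ≈ y})

    -- True (em {P}) is a proof-irrelevant version of P, so an element of Q is
    -- just the characteristic function of an equivalence class.
    Q : Set
    Q = Σ (A → Bool) λ c → True (em {∃[ x ] c ≡ class x})

    private
      does-cong : {P R : Set} (P? : Dec P) (R? : Dec R) →
                  (P → R) → (R → P) → does P? ≡ does R?
      does-cong (yes _) (yes _)  _ _ = refl
      does-cong (yes p) (no ¬r)  f _ = contradiction (f p) ¬r
      does-cong (no ¬p) (yes r)  _ g = contradiction (g r) ¬p
      does-cong (no _)  (no _)   _ _ = refl

      does-complete : {P : Set} (P? : Dec P) → P → does P? ≡ true
      does-complete (yes _) _ = refl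
      does-complete (no ¬p) p = contradiction p ¬p

      does-sound : {P : Set} (P? : Dec P) → does P? ≡ true → P
      does-sound (yes p) _ = p

      class-cong : ∀ {x y} → x ≈ y → class x ≡ class y
      class-cong x≈y = ext λ _ →
        does-cong em em (≈-trans (≈-sym x≈y)) (≈-trans x≈y)

      class-injective : ∀ {x y} → class x ≡ class y → x ≈ y
      class-injective {x} {y} e = does-sound em
        (trans (cong (λ c → c y) e) (does-complete em ≈-refl))

      Q-≡ : {q r : Q} → proj₁ q ≡ proj₁ r → q ≡ r
      Q-≡ {c , s} {.c , t} refl = cong (c ,_) (T-irrelevant s t)

    [_] : A → Q
    [ x ] = class x , fromWitness (x , refl)

    quotient : Bijection S (setoid Q)
    quotient = record
      { to        = [_]
      ; cong      = Q-≡ ∘ class-cong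
      ; bijective = (class-injective ∘ cong proj₁) , λ (c , t) →
          let (x , c≡) = toWitness t in
          x , λ z≈x → Q-≡ (trans (class-cong z≈x) (sym c≡))
      }

  module Ultraproduct {I : Set} (𝔘 : Ultrafilter I) (X : I → Set) where
    open Ultrafilter 𝔘

    open Quotient (agreeSetoid 𝔘 X) public
      using ([_]; quotient) renaming (Q to ∏)

    ∏-subset : (∀ i → 𝒫 (X i)) → 𝒫 ∏
    ∏-subset A q = ∃[ x ] [ x ] ≡ q × Large (λ i → A i (x i))

  module _ {Λ : Set} {F : Functor} (S : Structure Λ F) where
    open Functor F
    open Structure S
    open Coalgebra

    IsQuasiUltraproduct :
      {I : Set} (C : I → Coalgebra F) (𝔘 : Ultrafilter I) →
      let open Ultraproduct 𝔘 (Carrier ∘ C) in (∏ → F₀ ∏) → Set₁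
    IsQuasiUltraproduct {I} C 𝔘 ζ =
      (A : ∀ i → 𝒫 (Carrier (C i))) (x : ∀ i → Carrier (C i)) (♥ : Λ) →
      ⟦ ♥ ⟧ (∏-subset A) (ζ [ x ]) ⇔ Large (λ i → ⟦ ♥ ⟧ (A i) (ξ (C i) (x i)))
      where
      open Ultrafilter 𝔘
      open Ultraproduct 𝔘 (Carrier ∘ C)

    HasQuasiUltraproducts : Set₁
    HasQuasiUltraproducts =
      (I : Set) (C : I → Coalgebra F) → (∀ i → Carrier (C i)) →
      (𝔘 : Ultrafilter I) → ∃[ ζ ] IsQuasiUltraproduct C 𝔘 ζ

{-# OPTIONS --safe #-}

-- Every finite subset of the ultraproduct ∏ is an ultraproduct of finite sets,
-- read off from chosen representatives.  For x ∈ ∏ let Φₓ consist of the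
-- one-step formulas over ∏ that, translated in this way, hold at ξᵢ(xᵢ) for
-- 𝔘-almost all i.  A finite subset of Φₓ mentions finitely many points of ∏;
-- for almost all i they are separated at i, so there is a map f : Xᵢ → ∏ sending
-- their representatives back to them and all else away from them, and by
-- naturality T f (ξᵢ(xᵢ)) satisfies the subset.  Compactness yields ζ(x) ⊨ Φₓ,
-- and boundedness reduces arbitrary families (Aᵢ) to finite ones.
module Submission where

open import Defs
open import Axiom.ExcludedMiddle using (ExcludedMiddle)
open import Axiom.Extensionality.Propositional using (Extensionality)
open import Data.Empty using (⊥-elim)
open import Data.List using (List; []; _∷_; _++_; map; length)
open import Data.List.Membership.Propositional using (_∈_; _∉_)
open import Data.List.Membership.Propositional.Properties
  using (∈-map⁺; ∈-map⁻; ∈-++⁺ˡ; ∈-++⁺ʳ)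
open import Data.List.Relation.Unary.Any using (here; there)
open import Data.Nat using (zero; suc; _≤_; z≤n; s≤s)
open import Data.Nat.Properties using (≤-refl)
open import Data.Product using (∃; ∃-syntax; _×_; _,_; proj₁; proj₂)
import Data.Product as Product
open import Data.Sum using (inj₁; inj₂; fromInj₁)
import Data.Sum as Sum
open import Data.Unit using (tt)
open import Function
  using (_∘_; _$_; id; _⇔_; mk⇔; Bijection; Equivalence; case_of_)
open import Level using (0ℓ; Lift; lift; lower) renaming (suc to lsuc)
open import Relation.Binary.PropositionalEquality
  using (_≡_; refl; sym; trans; cong₂; subst)
open import Relation.Nullary using (¬_; yes; no; contradiction)
open import Relation.Unary using (Pred; _⊆_; _≐_; ∁; U; _⊢_)

-- Ultrafilters and enumerated sets.

module _ {I : Set} (𝔘 : Ultrafilter I) where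
  open Ultrafilter 𝔘

  ¬Large⇒Large-∁ : {A : 𝒫 I} → ¬ Large A → Large (∁ A)
  ¬Large⇒Large-∁ ¬a = fromInj₁ (⊥-elim ∘ ¬a) (Sum.swap (ultra _))

  Large-∈ : {A : Set} (xs : List A) {P : A → 𝒫 I} →
            (∀ {x} → x ∈ xs → Large (P x)) →
            Large (λ i → ∀ {x} → x ∈ xs → P x i)
  Large-∈ []       _ = upward (λ _ ()) whole
  Large-∈ (x ∷ xs) h = upward
    (λ { (p , ps) (here refl) → p ; (p , ps) (there m) → ps m })
    (meet (h (here refl)) (Large-∈ xs (h ∘ there)))

  Large⇒∃ : ExcludedMiddle 0ℓ → {A : 𝒫 I} → Large A → ∃ A
  Large⇒∃ em {A} a with em {∃ A}
  ... | yes e = e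
  ... | no ¬e = contradiction (upward (λ {i} p → ¬e (i , p)) a) proper

module _ {X : Set} where

  elements : {A : 𝒫 X} → Finite A → List X
  elements (_ , xs , _) = xs

  enumerated : (xs : List X) → Finite (_∈ xs)
  enumerated xs = length xs , xs , ≤-refl , id , id

-- One-step formulas and their translation along a map.

module _ {Λ : Set} {X : Set} where

  -- Reduces the satisfiability of a finite set of formulas to that of one formula.
  ⋀ : {𝒮 : Pred (𝒫 X) 0ℓ} → List (Formula Λ 𝒮) → Formula Λ 𝒮
  ⋀ []       = ⊤ᶠ
  ⋀ (φ ∷ φs) = φ ∧ᶠ ⋀ φs

  support : Formula Λ Finite → List X
  support (atom _ _ fin) = elements fin
  support ⊤ᶠ             = []
  support ⊥ᶠ             = []
  support (¬ᶠ φ)         = support φ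
  support (φ ∧ᶠ ψ)       = support φ ++ support ψ
  support (φ ∨ᶠ ψ)       = support φ ++ support ψ

  translate : {Y : Set} → (X → Y) → Formula Λ {X} Finite → Formula Λ {Y} U
  translate g (atom ♥ _ fin) = atom ♥ (_∈ map g (elements fin)) tt
  translate g ⊤ᶠ             = ⊤ᶠ
  translate g ⊥ᶠ             = ⊥ᶠ
  translate g (¬ᶠ φ)         = ¬ᶠ translate g φ
  translate g (φ ∧ᶠ ψ)       = translate g φ ∧ᶠ translate g ψ
  translate g (φ ∨ᶠ ψ)       = translate g φ ∨ᶠ translate g ψ

-- Monotonicity and the truth of translated formulas.

module _ {Λ : Set} {F : Functor} (S : Structure Λ F) where
  open Functor F
  open Structure S

  bounded⇒monotone : ∀ {♥} → Bounded S ♥ →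
                     {X : Set} {A B : 𝒫 X} → A ⊆ B → ⟦ ♥ ⟧ A ⊆ ⟦ ♥ ⟧ B
  bounded⇒monotone (k , bd) {X} A⊆B t∈ =
    let (B′ , B′⊆A , card , t∈′) = proj₁ (bd X _) t∈ in
    proj₂ (bd X _) (B′ , A⊆B ∘ B′⊆A , card , t∈′)

  Holds-⋀ : {X : Set} {𝒮 : Pred (𝒫 X) 0ℓ} {t : F₀ X} (φs : List (Formula Λ 𝒮)) →
            Holds S t (⋀ φs) → ∀ {φ} → φ ∈ φs → Holds S t φ
  Holds-⋀ (_ ∷ _)  (h , _) (here refl) = h
  Holds-⋀ (_ ∷ φs) (_ , h) (there m)   = Holds-⋀ φs h m

  module _ {X Y : Set} (f : Y → X) (g : X → Y) where

    -- Naturality turns an atom at `F₁ f s` into an atom at `s` over a preimage under `f`; this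
    -- condition identifies that preimage with the image under `g` that `translate` uses.
    Reflects : List X → Set
    Reflects xs = ∀ zs → (_∈ zs) ⊆ (_∈ xs) → (f ⊢ (_∈ zs)) ≐ (_∈ map g zs)

    -- `xs` stays fixed while the support shrinks, so one reflection hypothesis serves all
    -- subformulas.
    Holds-translate : {s : F₀ Y} {xs : List X} → Reflects xs →
                      (φ : Formula Λ Finite) → (_∈ support φ) ⊆ (_∈ xs) →
                      Holds S s (translate g φ) ⇔ Holds S (F₁ f s) φ
    Holds-translate {s} r (atom ♥ A fin@(_ , zs , _ , A⊆ , ⊆A)) sub = mk⇔
      (λ h → proj₂ (natural ♥ f A) (proj₂ (⟦⟧-cong ♥ eq) h))
      (λ h → proj₁ (⟦⟧-cong ♥ eq) (proj₁ (natural ♥ f A) h))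
      where
      eq : (f ⊢ A) ≐ (_∈ map g zs)
      eq = (proj₁ (r zs sub) ∘ A⊆) , (⊆A ∘ proj₂ (r zs sub))
    Holds-translate r ⊤ᶠ sub = mk⇔ id id
    Holds-translate r ⊥ᶠ sub = mk⇔ id id
    Holds-translate r (¬ᶠ φ) sub =
      let e = Holds-translate r φ sub in
      mk⇔ (_∘ Equivalence.from e) (_∘ Equivalence.to e)
    Holds-translate r (φ ∧ᶠ ψ) sub =
      let e = Holds-translate r φ (sub ∘ ∈-++⁺ˡ)
          d = Holds-translate r ψ (sub ∘ ∈-++⁺ʳ (support φ)) in
      mk⇔ (Product.map (Equivalence.to e) (Equivalence.to d))
          (Product.map (Equivalence.from e) (Equivalence.from d))
    Holds-translate r (φ ∨ᶠ ψ) sub =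
      let e = Holds-translate r φ (sub ∘ ∈-++⁺ˡ)
          d = Holds-translate r ψ (sub ∘ ∈-++⁺ʳ (support φ)) in
      mk⇔ (Sum.map (Equivalence.to e) (Equivalence.to d))
          (Sum.map (Equivalence.from e) (Equivalence.from d))

module _ (em : ExcludedMiddle 0ℓ) (ext : Extensionality 0ℓ 0ℓ) where

  -- Representatives of points of the ultraproduct.

  module Representatives {I : Set} (𝔘 : Ultrafilter I) (X : I → Set)
                         (point : ∀ i → X i) where
    open Ultrafilter 𝔘
    open Classical.Ultraproduct em ext 𝔘 X

    -- Abstract because conversion checking explodes once em unfolds in terms.
    abstract
      rep : ∏ → ∀ i → X i
      rep q = proj₁ (Bijection.surjective quotient q)

      [rep] : ∀ q → [ rep q ] ≡ q
      [rep] q = proj₂ (Bijection.surjective quotient q) (upward (λ _ → refl) whole)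

    []-cong : ∀ {x y} → Large (λ i → x i ≡ y i) → [ x ] ≡ [ y ]
    []-cong = Bijection.cong quotient

    []-injective : ∀ {x y} → [ x ] ≡ [ y ] → Large (λ i → x i ≡ y i)
    []-injective = Bijection.injective quotient

    rep-[] : ∀ x → Large (λ i → rep [ x ] i ≡ x i)
    rep-[] x = []-injective ([rep] [ x ])

    at : ∀ i → ∏ → X i
    at i q = rep q i

    at-separates : ∀ p q → Large (λ i → at i p ≡ at i q → p ≡ q)
    at-separates p q with em {p ≡ q}
    ... | yes p≡q = upward (λ _ _ → p≡q) whole
    ... | no  p≢q = upward (λ ¬e e → contradiction e ¬e) $ ¬Large⇒Large-∁ 𝔘
      λ large → p≢q (trans (sym ([rep] p)) (trans ([]-cong large) ([rep] q)))

    module Section (xs : List ∏) where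

      choose-fresh : ∀ i → ∃[ y ] (∀ z → z ∉ map (at i) xs → y ∉ map (at i) xs)
      choose-fresh i with em {∃[ z ] z ∉ map (at i) xs}
      ... | yes (z , z∉) = z , λ _ _ → z∉
      -- The listed values exhaust the factor, so any default will do: the condition is vacuous.
      ... | no  ¬∃       = point i , λ z z∉ → contradiction (z , z∉) ¬∃

      fresh : ∏
      fresh = [ proj₁ ∘ choose-fresh ]

      -- Either fresh lies outside xs, or xs exhausts almost all of the factors.
      fresh-∉ : Large (λ i → ∀ z → z ∉ map (at i) xs → fresh ∉ xs)
      fresh-∉ = upward
        (λ {i} e z z∉ y∈ → proj₂ (choose-fresh i) z z∉
          (subst (_∈ map (at i) xs) e (∈-map⁺ (at i) y∈)))
        (rep-[] _)

      -- The point `p` is determined by `z` only at those `i` that separate the points of `xs`.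
      section : ∀ i → X i → ∏
      section i z with em {∃[ p ] p ∈ xs × z ≡ at i p}
      ... | yes (p , _) = p
      ... | no  _       = fresh

      section-reflects : ∀ {Λ F} (S : Structure Λ F) →
                         Large (λ i → Reflects S (section i) (at i) xs)
      section-reflects S = upward reflects $ meet fresh-∉ $
        Large-∈ 𝔘 xs λ {p} _ → Large-∈ 𝔘 xs λ {q} _ → at-separates p q
        where
        reflects : ∀ {i} →
          (∀ z → z ∉ map (at i) xs → fresh ∉ xs) ×
          (∀ {p} → p ∈ xs → ∀ {q} → q ∈ xs → at i p ≡ at i q → p ≡ q) →
          Reflects S (section i) (at i) xs
        reflects {i} (out , sep) zs zs⊆xs = to , from
          where
          to : (section i ⊢ (_∈ zs)) ⊆ (_∈ map (at i) zs)
          to {z} h with em {∃[ p ] p ∈ xs × z ≡ at i p}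
          ... | yes (p , _ , refl) = ∈-map⁺ (at i) h
          -- Here `h` puts `fresh` into `zs`, but `z` itself is an unlisted value, which forces
          -- `fresh` out of `xs`.
          ... | no ¬∃ = contradiction (zs⊆xs h) (out z (¬∃ ∘ ∈-map⁻ (at i)))

          from : (_∈ map (at i) zs) ⊆ (section i ⊢ (_∈ zs))
          from {z} h with ∈-map⁻ (at i) h | em {∃[ p ] p ∈ xs × z ≡ at i p}
          ... | q , q∈ , z≡ | yes (p , p∈ , z≡′) =
            subst (_∈ zs) (sep (zs⊆xs q∈) p∈ (trans (sym z≡) z≡′)) q∈
          ... | q , q∈ , z≡ | no ¬∃ = contradiction (q , zs⊆xs q∈ , z≡) ¬∃

    -- The uniform bound drives the induction: either almost all lists are empty, or the heads form
    -- a point of `∏` and the tails obey a smaller bound.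
    bounded-lists : ∀ k (ls : ∀ i → List (X i)) → (∀ i → length (ls i) ≤ k) →
                    ∃[ qs ] Large (λ i → map (at i) qs ≡ ls i)
    bounded-lists zero ls len = [] , upward (λ {i} _ → empty (ls i) (len i)) whole
      where
      empty : ∀ {i} (l : List (X i)) → length l ≤ 0 → [] ≡ l
      empty [] _ = refl
    bounded-lists (suc k) ls len with ultra (λ i → [] ≡ ls i)
    ... | inj₁ large = [] , large
    ... | inj₂ large =
      let (qs , tails) = bounded-lists k (λ i → tail (ls i)) (λ i → shorter (ls i) (len i))
      in [ heads ] ∷ qs ,
         upward (λ (ne , h , t) → trans (cong₂ _∷_ h t) (uncons ne))
           (meet large (meet (rep-[] heads) tails))
      where
      head : ∀ i → List (X i) → X i
      -- A harmless default: in this branch almost all lists are nonempty.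
      head i []      = point i
      head i (x ∷ _) = x

      tail : ∀ {i} → List (X i) → List (X i)
      tail []       = []
      tail (_ ∷ xs) = xs

      heads : ∀ i → X i
      heads i = head i (ls i)

      shorter : ∀ {i} (l : List (X i)) → length l ≤ suc k → length (tail l) ≤ k
      shorter []      _       = z≤n
      shorter (_ ∷ _) (s≤s p) = p

      uncons : ∀ {i} {l : List (X i)} → ¬ [] ≡ l → head i l ∷ tail l ≡ l
      uncons {l = []}    ne = contradiction refl ne
      uncons {l = _ ∷ _} _  = refl

  -- Construction of the quasi-ultraproduct.

  module _ {Λ : Set} {F : Functor} (S : Structure Λ F)
           (compact : FinitaryOneStepCompact S) (bounded : ∀ ♥ → Bounded S ♥)
           {I : Set} (C : I → Coalgebra F)
           (point : ∀ i → Coalgebra.Carrier (C i)) (𝔘 : Ultrafilter I) where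
    open Functor F
    open Structure S
    open Coalgebra
    open Ultrafilter 𝔘
    open Classical.Ultraproduct em ext 𝔘 (Carrier ∘ C)
    open Representatives 𝔘 (Carrier ∘ C) point

    module _ (q : ∏) where

      state : ∀ i → F₀ (Carrier (C i))
      state i = ξ (C i) (at i q)

      Theory : Pred (Formula Λ Finite) (lsuc 0ℓ)
      Theory φ = Lift _ (Large (λ i → Holds S (state i) (translate (at i) φ)))

      Theory-⋀ : ∀ φs → (∀ {φ} → φ ∈ φs → Theory φ) → Theory (⋀ φs)
      Theory-⋀ []       _ = lift (upward (λ _ → tt) whole)
      Theory-⋀ (φ ∷ φs) h =
        lift (meet (lower (h (here refl))) (lower (Theory-⋀ φs (h ∘ there))))

      -- Large sets are inhabited, so some single `i` makes the translation true and lets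
      -- `section i` reflect the support; the state there is pushed forward.
      Theory-model : ∀ φ → Theory φ → ∃[ t ] Holds S t φ
      Theory-model φ (lift large) = F₁ (section i) (state i) ,
        Equivalence.to (Holds-translate S (section i) (at i) r φ id) h
        where
        open Section (support φ)
        good = Large⇒∃ 𝔘 em (meet large (section-reflects S))
        i = proj₁ good
        h = proj₁ (proj₂ good)
        r = proj₂ (proj₂ good)

      abstract
        Theory-satisfiable : Satisfiable S Theory
        Theory-satisfiable = compact ∏ Theory λ Ψ Ψ⊆ (_ , φs , _ , Ψ⊆φs , φs⊆Ψ) →
          let (t , h) = Theory-model (⋀ φs) (Theory-⋀ φs (Ψ⊆ ∘ φs⊆Ψ)) in
          t , λ φ ψ → Holds-⋀ S φs h (Ψ⊆φs ψ)

      ζ : F₀ ∏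
      ζ = proj₁ Theory-satisfiable

      -- If the index set is not large, its complement is, so `Theory` contains the negated atom.
      ζ-finite : ∀ ♥ {A : 𝒫 ∏} (fin : Finite A) →
        ⟦ ♥ ⟧ A ζ ⇔ Large (λ i → ⟦ ♥ ⟧ (_∈ map (at i) (elements fin)) (state i))
      ζ-finite ♥ fin = mk⇔
        (λ h → case ultra _ of λ where
          (inj₁ large) → large
          (inj₂ large) →
            contradiction h (proj₂ Theory-satisfiable (¬ᶠ atom ♥ _ fin) (lift large)))
        (λ large → proj₂ Theory-satisfiable (atom ♥ _ fin) (lift large))

    module _ (A : ∀ i → 𝒫 (Carrier (C i))) (x : ∀ i → Carrier (C i)) (♥ : Λ) where

      private
        k = proj₁ (bounded ♥)
        approximate = λ {X} {B} {t} → proj₁ (proj₂ (bounded ♥) X B) {t}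

      -- Boundedness yields a finite `B` inside `∏-subset A`; almost everywhere the values of its
      -- points lie in `A i`, and monotonicity applies.
      ∏-subset⇒Large : ⟦ ♥ ⟧ (∏-subset A) (ζ [ x ]) →
                       Large (λ i → ⟦ ♥ ⟧ (A i) (ξ (C i) (x i)))
      ∏-subset⇒Large h with approximate h
      ... | B , B⊆ , fin@(qs , _ , _ , qs⊆B) , h′ = upward
        (λ {i} (e , inside , l) → subst (λ y → ⟦ ♥ ⟧ (A i) (ξ (C i) y)) e
          (bounded⇒monotone S (bounded ♥) (within inside) l))
        (meet (rep-[] x) (meet (Large-∈ 𝔘 qs rep∈)
          (Equivalence.to (ζ-finite [ x ] ♥ {B} (k , fin)) h′)))
        where
        rep∈ : ∀ {q} → q ∈ qs → Large (λ i → A i (at i q))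
        rep∈ {q} q∈ with B⊆ (qs⊆B q∈)
        ... | y , y≡ , ya = upward (λ {i} (e , a) → subst (A i) e a)
          (meet ([]-injective (trans y≡ (sym ([rep] q)))) ya)

        within : ∀ {i} → (∀ {q} → q ∈ qs → A i (at i q)) →
                 (_∈ map (at i) qs) ⊆ A i
        within {i} inside z∈ with ∈-map⁻ (at i) z∈
        ... | _ , q∈ , refl = inside q∈

      witness : ∀ i → ∃[ l ] length l ≤ k ×
        (⟦ ♥ ⟧ (A i) (ξ (C i) (x i)) → (_∈ l) ⊆ A i × ⟦ ♥ ⟧ (_∈ l) (ξ (C i) (x i)))
      witness i with em {⟦ ♥ ⟧ (A i) (ξ (C i) (x i))}
      -- A default list, since `bounded-lists` wants the length bound at every index.
      ... | no ¬h = [] , z≤n , λ h → contradiction h ¬h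
      ... | yes h with approximate h
      ... | _ , B⊆A , (l , len , B≐) , h′ =
        l , len , λ _ → B⊆A ∘ proj₂ B≐ , proj₁ (⟦⟧-cong ♥ B≐) h′

      -- The witnessing lists of the factors glue to finitely many points of `∏`, to which the
      -- finite case applies.
      Large⇒∏-subset : Large (λ i → ⟦ ♥ ⟧ (A i) (ξ (C i) (x i))) →
                       ⟦ ♥ ⟧ (∏-subset A) (ζ [ x ])
      Large⇒∏-subset large
        with bounded-lists k (proj₁ ∘ witness) (proj₁ ∘ proj₂ ∘ witness)
      ... | qs , eqs = bounded⇒monotone S (bounded ♥) qs⊆
        (Equivalence.from (ζ-finite [ x ] ♥ (enumerated qs))
          (upward holds (meet (rep-[] x) (meet eqs large))))
        where
        qs⊆ : (_∈ qs) ⊆ ∏-subset A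
        qs⊆ {q} q∈ = rep q , [rep] q , upward
          (λ {i} (e , h) → proj₁ (proj₂ (proj₂ (witness i)) h)
            (subst (at i q ∈_) e (∈-map⁺ (at i) q∈)))
          (meet eqs large)

        holds : ∀ {i} → rep [ x ] i ≡ x i ×
                map (at i) qs ≡ proj₁ (witness i) × ⟦ ♥ ⟧ (A i) (ξ (C i) (x i)) →
                ⟦ ♥ ⟧ (_∈ map (at i) qs) (state [ x ] i)
        holds {i} (x≡ , qs≡ , h) =
          subst (λ y → ⟦ ♥ ⟧ (_∈ map (at i) qs) (ξ (C i) y)) (sym x≡)
            (subst (λ l → ⟦ ♥ ⟧ (_∈ l) (ξ (C i) (x i))) (sym qs≡)
              (proj₂ (proj₂ (proj₂ (witness i)) h)))

theorem5p8 : (em : ExcludedMiddle 0ℓ) (ext : Extensionality 0ℓ 0ℓ) →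
    (Λ : Set) (F : Functor) (S : Structure Λ F) →
    FinitaryOneStepCompact S →
    (∀ ♥ → Bounded S ♥) →
    Classical.HasQuasiUltraproducts em ext S
theorem5p8 em ext Λ F S compact bounded I C point 𝔘 =
  ζ em ext S compact bounded C point 𝔘 , λ A x ♥ → mk⇔
    (∏-subset⇒Large em ext S compact bounded C point 𝔘 A x ♥)
    (Large⇒∏-subset em ext S compact bounded C point 𝔘 A x ♥)
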